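{- Let $a\le b$ be natural numbers with $b\ge1$. Then there exists a family of simple connected graphs $\{G_n\}$, indexed by odd $n$, such that $\lim_{n\to\infty,\ n\text{ odd}}\mathrm{rate}(\mathcal{C}(\mathcal{P}_{G_n}))=a/b$.
   Context: For a simple connected graph $G$ on $[m]$ with Laplacian matrix $L$ ($L_{ii}=\deg(i)$, $L_{ij}=-1$ if $\{i,j\}$ is an edge, $0$ otherwise) and $L(m)$ being $L$ with its $m$-th column deleted, the associated linear code is $\mathcal{C}(\mathcal{P}_G)=\{\bar{\mathbf{x}}\in\mathbb{Z}_m^m\mid\bar{\mathbf{x}}[L(m)\mid\mathbb{1}]=\mathbf{0}\text{ in }\mathbb{Z}_m^m\}$, where $[L(m)\mid\mathbb{1}]$ is $L(m)$ with a column of ones appended. The rate of a code $\mathcal{C}\subseteq\mathbb{Z}_q^N$ is $\log_q(|\mathcal{C}|)/N$. -}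

module Defs where

open import Data.Bool using (Bool; true; false; if_then_else_)
open import Data.Nat as ℕ using (ℕ; zero; suc; _∸_; _<ᵇ_)
import Data.Nat.Divisibility as ℕD
open import Data.Fin using (Fin; toℕ; _≟_)
open import Data.Fin.Properties using (all?)
open import Data.Integer as ℤ using (ℤ; +_; -_)
open import Data.Integer.Divisibility using (_∣_)
open import Data.List as List using (List; []; _∷_; length; filter; concatMap; map; allFin; tabulate; foldr)
open import Data.Vec using (Vec; []; _∷_; lookup)
open import Data.Product using (Σ)
open import Relation.Nullary using (Dec; yes; no; does)
open import Relation.Binary.PropositionalEquality using (_≡_)

record Graph (m : ℕ) : Set where
  field
    adj    : Fin m → Fin m → Bool
    sym    : ∀ i j → adj i j ≡ adj j i
    irrefl : ∀ i → adj i i ≡ false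
open Graph public

data Walk {m : ℕ} (G : Graph m) : Fin m → Fin m → Set where
  here : ∀ {i} → Walk G i i
  step : ∀ {i j k} → adj G i j ≡ true → Walk G j k → Walk G i k

Connected : ∀ {m} → Graph m → Set
Connected {m} G = ∀ (i j : Fin m) → Walk G i j

degree : ∀ {m} → Graph m → Fin m → ℕ
degree {m} G i = length (filter (λ j → Data.Bool._≟_ (adj G i j) true) (allFin m))

laplacian : ∀ {m} → Graph m → Fin m → Fin m → ℤ
laplacian G i j with does (i ≟ j)
... | true  = + degree G i
... | false = if adj G i j then - (+ 1) else + 0

-- The matrix [L(m) | 1]: column c (0-based) is column c of L for c < m-1,
-- and the last column (c = m-1) is the all-ones column.
codeMatrix : ∀ {m} → Graph m → Fin m → Fin m → ℤ
codeMatrix {m} G i c = if toℕ c <ᵇ (m ∸ 1) then laplacian G i c else + 1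

sumℤ : ∀ {n} → (Fin n → ℤ) → ℤ
sumℤ f = foldr ℤ._+_ (+ 0) (tabulate f)

-- x ∈ ℤ_m^m (entries as Fin m, i.e. representatives 0..m-1) lies in C(P_G)
-- iff x [L(m) | 1] = 0 in ℤ_m^m.
InCode : ∀ {m} → Graph m → Vec (Fin m) m → Set
InCode {m} G x = ∀ (c : Fin m) →
  (+ m) ∣ sumℤ (λ i → (+ toℕ (lookup x i)) ℤ.* codeMatrix G i c)

InCode? : ∀ {m} (G : Graph m) (x : Vec (Fin m) m) → Dec (InCode G x)
InCode? {m} G x = all? (λ c → ℕD._∣?_ m _)

allVecs : ∀ {A : Set} → List A → (l : ℕ) → List (Vec A l)
allVecs xs zero    = [] ∷ []
allVecs xs (suc l) = concatMap (λ a → map (a ∷_) (allVecs xs l)) xs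

codeSize : ∀ {m} → Graph m → ℕ
codeSize {m} G = length (filter (InCode? G) (allVecs (allFin m) m))

Odd : ℕ → Set
Odd n = Σ ℕ (λ k → n ≡ suc (2 ℕ.* k))

-- Since agda-stdlib has no reals/logarithms, |log_n c / n - a/b| < 1/k
-- (for n ≥ 2, c ≥ 1) is written as the equivalent integer inequalities
--   n^(n·a·k) < c^(b·k) · n^(n·b)   and   c^(b·k) < n^(n·(a·k + b)).
RateTendsTo : (size : (n : ℕ) → Odd n → ℕ) → ℕ → ℕ → Set
RateTendsTo size a b =
  ∀ (k : ℕ) → 1 ℕ.≤ k → Σ ℕ λ N → ∀ (n : ℕ) (o : Odd n) → N ℕ.≤ n →
    (n ℕ.^ (n ℕ.* (a ℕ.* k)) ℕ.< (size n o ℕ.^ (b ℕ.* k)) ℕ.* (n ℕ.^ (n ℕ.* b)))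
    Data.Product.× (size n o ℕ.^ (b ℕ.* k) ℕ.< n ℕ.^ (n ℕ.* (a ℕ.* k ℕ.+ b)))

-- Take for G_n the complement Ḡ of the star H = K_{1,q} on the vertices 0, …, n − 1, with centre 0
-- and leaves 1, …, q, where q ≤ n − 2.  Since L(Ḡ) = nI − J − L(H), modulo n every column of x L(Ḡ)
-- is − Σx minus the same column of x L(H), and the all-ones column of [L(n) | 1] forces Σx ≡ 0.
-- The column of x L(H) at a leaf j is x_j − x_0, and all columns of x L(H) vanish once the leaves
-- agree with the centre.  Hence x is a code word iff x_1 = … = x_q = x_0 and Σx ≡ 0 (mod n), so the
-- code has n ^ (n − 1 − q) words.  With q = (n − 2) − ⌊(n − 2)a/b⌋ the exponent e = 1 + ⌊(n − 2)a/b⌋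
-- satisfies |e b − n a| ≤ 2b, so the rate e/n tends to a/b.  Ḡ is connected because its last
-- vertex is adjacent to all others.

module Submission where

open import Algebra.Bundles using (CommutativeMonoid)
open import Data.Bool using (Bool; true; false; not; _∧_; if_then_else_)
open import Data.Bool.Properties using (T-≡)
open import Data.Empty using (⊥-elim)
open import Data.Fin using (Fin; zero; suc; toℕ; fromℕ; fromℕ<; punchIn; _≟_)
open import Data.Fin.Properties using (punchInᵢ≢i; toℕ-fromℕ<; toℕ-injective; toℕ<n; all?)
open import Data.List using (List; []; _∷_; length; filter; tabulate; allFin; map; _++_; concatMap)
open import Data.List.Properties using (filter-≐; filter-++; length-++; filter-accept; filter-none)
import Data.List.Relation.Unary.All as All
open import Data.Nat.Base using (ℕ; zero; suc; pred; NonZero; _≤_)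
open import Data.Product using (Σ; _×_; _,_; proj₁; proj₂)
open import Data.Product.Function.NonDependent.Propositional using (_×-⇔_)
open import Data.Vec using (Vec; []; _∷_; lookup)
open import Data.Vec.Functional using (Vector)
open import Function using (_∘_; id)
open import Function.Bundles using (_⇔_; mk⇔; Equivalence)
import Function.Properties.Equivalence as ⇔
open import Level using (0ℓ)
open import Relation.Binary.PropositionalEquality
  using (_≡_; _≢_; refl; sym; trans; cong; cong₂; subst; module ≡-Reasoning)
open import Relation.Nullary using (Dec; yes; no; does; ¬_)
open import Relation.Nullary.Decidable using (dec-true; dec-false; _×-dec_; _→-dec_)
open import Relation.Unary using (Pred; Decidable)

open import Defs hiding (sym)

module _ {c ℓ} (M : CommutativeMonoid c ℓ) where
  open CommutativeMonoid M using (Carrier; _≈_; _∙_; ε; ∙-congˡ; identityʳ)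
    renaming (trans to ≈-trans)
  open import Algebra.Properties.CommutativeMonoid.Sum M
  open import Relation.Binary.Reasoning.Setoid (CommutativeMonoid.setoid M)

  sum-δ : ∀ {n} (t : Vector Carrier n) i → (∀ j → j ≢ i → t j ≈ ε) → sum t ≈ t i
  sum-δ {suc n} t i t≈ε = begin
    sum t                      ≈⟨ sum-remove t ⟩
    t i ∙ sum (t ∘ punchIn i)  ≈⟨ ∙-congˡ rest≈ε ⟩
    t i ∙ ε                    ≈⟨ identityʳ (t i) ⟩
    t i                        ∎
    where
    rest≈ε : sum (t ∘ punchIn i) ≈ ε
    rest≈ε = ≈-trans (sum-cong-≋ (λ j → t≈ε _ (punchInᵢ≢i i j))) (sum-replicate-zero n)

-- Laplacians of a graph and of its complement

module _ where
  open import Data.Integer using (ℤ; +_; 0ℤ; 1ℤ; -1ℤ; -_; _+_; _-_; _*_)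
  import Data.Integer.Properties as ℤP
  import Data.Integer.Divisibility.Signed as ℤS
  open import Data.Integer.Tactic.RingSolver using (solve-∀)
  open import Algebra.Properties.Semiring.Sum ℤP.+-*-semiring
  open import Algebra.Properties.Ring ℤP.+-*-ring using (x[y-z]≈xy-xz)
  open ≡-Reasoning

  sumℤ≡sum : ∀ {n} (f : Fin n → ℤ) → sumℤ f ≡ sum f
  sumℤ≡sum {zero}  f = refl
  sumℤ≡sum {suc n} f = cong (_+_ (f zero)) (sumℤ≡sum (f ∘ suc))

  private
    sum-const : ∀ n k → ∑[ i < n ] k ≡ + n * k
    sum-const zero    k = sym (ℤP.*-zeroˡ k)
    sum-const (suc n) k = trans (cong (_+_ k) (sum-const n k)) (sym (ℤP.suc-* (+ n) k))

  sum-- : ∀ {n} (f g : Fin n → ℤ) → ∑[ i < n ] (f i - g i) ≡ sum f - sum g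
  sum-- f g = begin
    ∑[ i < _ ] (f i - g i)              ≡⟨ ∑-distrib-+ f (λ i → - g i) ⟩
    sum f + ∑[ i < _ ] (- g i)          ≡⟨ cong (_+_ (sum f)) (sum-cong-≗ (λ i → sym (ℤP.-1*i≡-i (g i)))) ⟩
    sum f + ∑[ i < _ ] (-1ℤ * g i)      ≡⟨ cong (_+_ (sum f)) (*-distribˡ-sum -1ℤ g) ⟨
    sum f + -1ℤ * sum g                 ≡⟨ cong (_+_ (sum f)) (ℤP.-1*i≡-i (sum g)) ⟩
    sum f - sum g                       ∎

  ind : Bool → ℤ
  ind b = if b then 1ℤ else 0ℤ

  laplacian-diag : ∀ {n} (G : Graph n) i → laplacian G i i ≡ + degree G i
  laplacian-diag G i with i ≟ i
  ... | yes _  = refl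
  ... | no i≢i = ⊥-elim (i≢i refl)

  laplacian-offdiag : ∀ {n} (G : Graph n) {i j} → i ≢ j → laplacian G i j ≡ - ind (adj G i j)
  laplacian-offdiag G {i} {j} i≢j with i ≟ j
  ... | yes i≡j = ⊥-elim (i≢j i≡j)
  ... | no _ with adj G i j
  ...   | true  = refl
  ...   | false = refl

  degree≡sum : ∀ {n} (G : Graph n) i → + degree G i ≡ ∑[ j < n ] ind (adj G i j)
  degree≡sum G i = countTrue (adj G i) id
    where
    countTrue : ∀ {n k} (b : Fin n → Bool) (g : Fin k → Fin n) →
      + length (filter (λ j → b j Data.Bool.≟ true) (tabulate g)) ≡ ∑[ j < k ] ind (b (g j))
    countTrue {k = zero}  b g = refl
    countTrue {k = suc k} b g with b (g zero)
    ... | true  = cong (_+_ 1ℤ) (countTrue b (g ∘ suc))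
    ... | false = trans (countTrue b (g ∘ suc)) (sym (ℤP.+-identityˡ _))

  xL : ∀ {n} → Graph n → (Fin n → ℤ) → Fin n → ℤ
  xL {n} G x c = ∑[ i < n ] (x i * laplacian G i c)

  xL≡degree-∑adj : ∀ {n} (G : Graph n) (x : Fin n → ℤ) c →
    xL G x c ≡ + degree G c * x c - ∑[ i < n ] (ind (adj G i c) * x i)
  xL≡degree-∑adj {n} G x c = begin
    ∑[ i < n ] (x i * laplacian G i c)  ≡⟨ sum-cong-≗ (λ i → add-sub (x i * laplacian G i c) (a i * x i)) ⟩
    ∑[ i < n ] (u i - a i * x i)        ≡⟨ sum-- u (λ i → a i * x i) ⟩
    sum u - ∑[ i < n ] (a i * x i)      ≡⟨ cong (_- ∑[ i < n ] (a i * x i)) (sum-δ ℤP.+-0-commutativeMonoid u c u≡0) ⟩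
    u c - ∑[ i < n ] (a i * x i)        ≡⟨ cong (_- ∑[ i < n ] (a i * x i)) u-diag ⟩
    + degree G c * x c - ∑[ i < n ] (a i * x i) ∎
    where
    a : Fin n → ℤ
    a i = ind (adj G i c)
    u : Fin n → ℤ
    u i = x i * laplacian G i c + a i * x i
    add-sub : ∀ p q → p ≡ (p + q) - q
    add-sub = solve-∀
    u≡0 : ∀ j → j ≢ c → u j ≡ 0ℤ
    u≡0 j j≢c = trans (cong (λ l → x j * l + a j * x j) (laplacian-offdiag G j≢c)) (cancel (x j) (a j))
      where
      cancel : ∀ p q → p * - q + q * p ≡ 0ℤ
      cancel = solve-∀
    u-diag : u c ≡ + degree G c * x c
    u-diag = trans (cong₂ (λ l b → x c * l + ind b * x c) (laplacian-diag G c) (irrefl G c)) (diag (x c) (+ degree G c))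
      where
      diag : ∀ p d → p * d + 0ℤ * p ≡ d * p
      diag = solve-∀

  xL≡∑-differences : ∀ {n} (G : Graph n) (x : Fin n → ℤ) c →
    xL G x c ≡ ∑[ i < n ] (ind (adj G i c) * (x c - x i))
  xL≡∑-differences {n} G x c = begin
    xL G x c                                          ≡⟨ xL≡degree-∑adj G x c ⟩
    + degree G c * x c - ∑[ i < n ] (a i * x i)       ≡⟨ cong (λ d → d * x c - ∑[ i < n ] (a i * x i)) degree≡∑a ⟩
    sum a * x c - ∑[ i < n ] (a i * x i)              ≡⟨ cong (_- ∑[ i < n ] (a i * x i)) (*-distribʳ-sum (x c) a) ⟩
    ∑[ i < n ] (a i * x c) - ∑[ i < n ] (a i * x i)   ≡⟨ sum-- (λ i → a i * x c) (λ i → a i * x i) ⟨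
    ∑[ i < n ] (a i * x c - a i * x i)                ≡⟨ sum-cong-≗ (λ i → x[y-z]≈xy-xz (a i) (x c) (x i)) ⟨
    ∑[ i < n ] (a i * (x c - x i))                    ∎
    where
    a : Fin n → ℤ
    a i = ind (adj G i c)
    degree≡∑a : + degree G c ≡ sum a
    degree≡∑a = trans (degree≡sum G c) (sum-cong-≗ (λ i → cong ind (Graph.sym G c i)))

  xL≡0 : ∀ {n} (G : Graph n) (x : Fin n → ℤ) c → (∀ i → adj G i c ≡ true → x i ≡ x c) → xL G x c ≡ 0ℤ
  xL≡0 {n} G x c x-const = begin
    xL G x c                                    ≡⟨ xL≡∑-differences G x c ⟩
    ∑[ i < n ] (ind (adj G i c) * (x c - x i))  ≡⟨ sum-cong-≗ term ⟩
    ∑[ i < n ] 0ℤ                               ≡⟨ sum-replicate-zero n ⟩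
    0ℤ                                          ∎
    where
    term : ∀ i → ind (adj G i c) * (x c - x i) ≡ 0ℤ
    term i with adj G i c in i∼c
    ... | true rewrite x-const i i∼c = vanish (x c)
      where
      vanish : ∀ p → 1ℤ * (p - p) ≡ 0ℤ
      vanish = solve-∀
    ... | false = ℤP.*-zeroˡ (x c - x i)

  xL-pendant : ∀ {n} (G : Graph n) (x : Fin n → ℤ) c v →
    adj G v c ≡ true → (∀ i → i ≢ v → adj G i c ≡ false) → xL G x c ≡ x c - x v
  xL-pendant {n} G x c v v∼c others≁c = begin
    xL G x c                                    ≡⟨ xL≡∑-differences G x c ⟩
    ∑[ i < n ] (ind (adj G i c) * (x c - x i))  ≡⟨ sum-δ ℤP.+-0-commutativeMonoid _ v others-vanish ⟩
    ind (adj G v c) * (x c - x v)               ≡⟨ cong (λ b → ind b * (x c - x v)) v∼c ⟩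
    1ℤ * (x c - x v)                            ≡⟨ ℤP.*-identityˡ (x c - x v) ⟩
    x c - x v                                   ∎
    where
    others-vanish : ∀ i → i ≢ v → ind (adj G i c) * (x c - x i) ≡ 0ℤ
    others-vanish i i≢v = cong (λ b → ind b * (x c - x i)) (others≁c i i≢v)

  does-≟-sym : ∀ {n} (i j : Fin n) → does (i ≟ j) ≡ does (j ≟ i)
  does-≟-sym i j with i ≟ j
  ... | yes i≡j = sym (dec-true (j ≟ i) (sym i≡j))
  ... | no  i≢j = sym (dec-false (j ≟ i) (i≢j ∘ sym))

  complement : ∀ {n} → Graph n → Graph n
  complement H = record
    { adj    = λ i j → not (does (i ≟ j)) ∧ not (adj H i j)
    ; sym    = λ i j → cong₂ (λ e h → not e ∧ not h) (does-≟-sym i j) (Graph.sym H i j)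
    ; irrefl = λ i → cong (λ e → not e ∧ not (adj H i i)) (dec-true (i ≟ i) refl)
    }

  xL-complement : ∀ {n} (H : Graph n) (x : Fin n → ℤ) c →
    xL (complement H) x c ≡ + n * x c - sum x - xL H x c
  xL-complement {n} H x c = begin
    xL (complement H) x c                              ≡⟨ xL≡∑-differences (complement H) x c ⟩
    ∑[ i < n ] (ind (adj (complement H) i c) * d i)    ≡⟨ sum-cong-≗ term ⟩
    ∑[ i < n ] (d i - ind (adj H i c) * d i)           ≡⟨ sum-- d (λ i → ind (adj H i c) * d i) ⟩
    sum d - ∑[ i < n ] (ind (adj H i c) * d i)         ≡⟨ cong₂ _-_ (sym (sum-- (λ _ → x c) x)) (xL≡∑-differences H x c) ⟨
    ∑[ i < n ] x c - sum x - xL H x c                  ≡⟨ cong (λ s → s - sum x - xL H x c) (sum-const n (x c)) ⟩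
    + n * x c - sum x - xL H x c                       ∎
    where
    d : Fin n → ℤ
    d i = x c - x i
    term : ∀ i → ind (adj (complement H) i c) * d i ≡ d i - ind (adj H i c) * d i
    term i with i ≟ c
    ... | yes refl rewrite irrefl H i = vanish (x i)
      where
      vanish : ∀ p → 0ℤ * (p - p) ≡ (p - p) - 0ℤ * (p - p)
      vanish = solve-∀
    ... | no _ with adj H i c
    ...   | true = adjacent (d i)
      where
      adjacent : ∀ p → 0ℤ * p ≡ p - 1ℤ * p
      adjacent = solve-∀
    ...   | false = nonadjacent (d i)
      where
      nonadjacent : ∀ p → 1ℤ * p ≡ p - 0ℤ * p
      nonadjacent = solve-∀

  xL-complement-∣ : ∀ {n} (H : Graph n) (x : Fin n → ℤ) c → + n ℤS.∣ sum x →
    + n ℤS.∣ xL (complement H) x c ⇔ + n ℤS.∣ xL H x c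
  xL-complement-∣ {n} H x c n∣∑x = mk⇔ to from
    where
    n∣nx-∑x : + n ℤS.∣ + n * x c - sum x
    n∣nx-∑x = ℤS.∣m∣n⇒∣m-n (ℤS.∣m⇒∣m*n (x c) ℤS.∣-refl) n∣∑x
    to : + n ℤS.∣ xL (complement H) x c → + n ℤS.∣ xL H x c
    to n∣xL̄ = subst (+ n ℤS.∣_) (ℤP.neg-involutive _)
      (ℤS.∣m⇒∣-m (ℤS.∣m+n∣m⇒∣n (subst (+ n ℤS.∣_) (xL-complement H x c) n∣xL̄) n∣nx-∑x))
    from : + n ℤS.∣ xL H x c → + n ℤS.∣ xL (complement H) x c
    from n∣xL = subst (+ n ℤS.∣_) (sym (xL-complement H x c)) (ℤS.∣m∣n⇒∣m-n n∣nx-∑x n∣xL)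

-- Residues and counting words

module _ where
  open import Data.Nat using (_+_; _*_; _∸_; _^_; _≤_; _<_; s<s; z<s; s<s⁻¹; _<?_)
  open import Data.Nat.Properties
    using (≤-antisym; m∸n≡0⇒m≤n; ≤-<-trans; m∸n≤m; ≤-total; *-suc; +-identityʳ; +-assoc; +-0-commutativeMonoid)
  open import Data.Nat.Divisibility using (_∣_; _∣?_; >⇒∤; m%n≡0⇒n∣m)
  open import Data.Nat.DivMod using (_%_; m%n<n; %-distribˡ-+; m%n%n≡m%n; m*n%n≡0)
  open import Data.Sum using (inj₁; inj₂)
  import Data.Integer as ℤ
  import Data.Integer.Properties as ℤP
  import Data.Integer.Divisibility.Signed as ℤS
  open import Data.Vec using () renaming (sum to sumᵛ; map to mapᵛ)
  open import Algebra.Properties.CommutativeMonoid.Sum +-0-commutativeMonoid using (sum; sum-syntax; sum-cong-≗)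
  open ≡-Reasoning

  ∣∧<⇒≡0 : ∀ {d k} → d ∣ k → k < d → k ≡ 0
  ∣∧<⇒≡0 {k = zero}  _   _   = refl
  ∣∧<⇒≡0 {k = suc k} d∣k k<d = ⊥-elim (>⇒∤ k<d d∣k)

  ordered-congruent⇒≡ : ∀ {d m n} → m ≤ n → n < d → d ∣ ℤ.∣ m ℤ.⊖ n ∣ → m ≡ n
  ordered-congruent⇒≡ {d} {m} {n} m≤n n<d d∣ = ≤-antisym m≤n (m∸n≡0⇒m≤n n∸m≡0)
    where
    n∸m≡0 : n ∸ m ≡ 0
    n∸m≡0 = ∣∧<⇒≡0 (subst (d ∣_) (ℤP.∣⊖∣-≤ m≤n) d∣) (≤-<-trans (m∸n≤m n m) n<d)

  small-congruent⇒≡ : ∀ {d m n} → m < d → n < d → d ∣ ℤ.∣ m ℤ.⊖ n ∣ → m ≡ n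
  small-congruent⇒≡ {d} {m} {n} m<d n<d d∣ with ≤-total m n
  ... | inj₁ m≤n = ordered-congruent⇒≡ m≤n n<d d∣
  ... | inj₂ n≤m = sym (ordered-congruent⇒≡ n≤m m<d (subst (d ∣_) (ℤP.∣m⊖n∣≡∣n⊖m∣ m n) d∣))

  -- s * N ≡ - s modulo N + 1
  negMod : ∀ {N} → ℕ → Fin (suc N)
  negMod {N} s = fromℕ< (m%n<n (s * N) (suc N))

  ∣+negMod : ∀ {N} s → suc N ∣ s + toℕ (negMod {N} s)
  ∣+negMod {N} s = m%n≡0⇒n∣m (s + toℕ (negMod s)) d (begin
    (s + toℕ (negMod s)) % d       ≡⟨ cong (λ v → (s + v) % d) (toℕ-fromℕ< _) ⟩
    (s + (s * N) % d) % d          ≡⟨ %-distribˡ-+ s ((s * N) % d) d ⟩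
    (s % d + (s * N) % d % d) % d  ≡⟨ cong (λ r → (s % d + r) % d) (m%n%n≡m%n (s * N) d) ⟩
    (s % d + (s * N) % d) % d      ≡⟨ %-distribˡ-+ s (s * N) d ⟨
    (s + s * N) % d                ≡⟨ cong (_% d) (*-suc s N) ⟨
    (s * d) % d                    ≡⟨ m*n%n≡0 s d ⟩
    0                              ∎)
    where
    d : ℕ
    d = suc N

  negMod-unique : ∀ {N} s (a : Fin (suc N)) → suc N ∣ s + toℕ a → a ≡ negMod s
  negMod-unique {N} s a N∣s+a = toℕ-injective (small-congruent⇒≡ (toℕ<n a) (toℕ<n (negMod s)) N∣a⊖v)
    where
    v : Fin (suc N)
    v = negMod s
    signed : ∀ {k} → suc N ∣ k → ℤ.+ suc N ℤS.∣ ℤ.+ k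
    signed {k} = ℤS.∣ᵤ⇒∣ {ℤ.+ suc N} {ℤ.+ k}
    N∣a⊖v : suc N ∣ ℤ.∣ toℕ a ℤ.⊖ toℕ v ∣
    N∣a⊖v = subst (λ z → suc N ∣ ℤ.∣ z ∣)
      (trans (ℤP.[+m]-[+n]≡m⊖n (s + toℕ a) (s + toℕ v)) (ℤP.+-cancelˡ-⊖ s (toℕ a) (toℕ v)))
      (ℤS.∣⇒∣ᵤ (ℤS.∣m∣n⇒∣m-n (signed N∣s+a) (signed (∣+negMod s))))

  private
    sum-const : ∀ n c → ∑[ i < n ] c ≡ n * c
    sum-const zero    c = refl
    sum-const (suc n) c = cong (c +_) (sum-const n c)

  length-filter-map : ∀ {A B : Set} {P : Pred B 0ℓ} (P? : Decidable P) (f : A → B) xs →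
    length (filter P? (map f xs)) ≡ length (filter (P? ∘ f) xs)
  length-filter-map P? f []       = refl
  length-filter-map P? f (x ∷ xs) with does (P? (f x))
  ... | true  = cong suc (length-filter-map P? f xs)
  ... | false = length-filter-map P? f xs

  -- Opaque: unfolded, `count P?` would not let unification recover `P?` in the lemmas below.
  opaque
    count : ∀ {N l} {P : Pred (Vec (Fin N) l) 0ℓ} → Decidable P → ℕ
    count {N} {l} P? = length (filter P? (allVecs (allFin N) l))

    count-cong : ∀ {N l} {P Q : Pred (Vec (Fin N) l) 0ℓ} (P? : Decidable P) (Q? : Decidable Q) →
      (∀ x → P x ⇔ Q x) → count P? ≡ count Q?
    count-cong {N} {l} P? Q? P⇔Q =
      cong length (filter-≐ P? Q? ((λ {x} → Equivalence.to (P⇔Q x)) , λ {x} → Equivalence.from (P⇔Q x)) (allVecs (allFin N) l))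

    count-none : ∀ {N l} {P : Pred (Vec (Fin N) l) 0ℓ} (P? : Decidable P) → (∀ x → ¬ P x) → count P? ≡ 0
    count-none {N} {l} P? ¬P = cong length (filter-none P? (All.universal ¬P (allVecs (allFin N) l)))

    count-[] : ∀ {N} {P : Pred (Vec (Fin N) 0) 0ℓ} (P? : Decidable P) → P [] → count P? ≡ 1
    count-[] P? p = cong length (filter-accept P? p)

    count-∷ : ∀ {N l} {P : Pred (Vec (Fin N) (suc l)) 0ℓ} (P? : Decidable P) →
      count P? ≡ ∑[ a < N ] count (λ y → P? (a ∷ y))
    count-∷ {N} {l} P? = blocks id
      where
      V : List (Vec (Fin N) l)
      V = allVecs (allFin N) l
      blocks : ∀ {k} (g : Fin k → Fin N) →
        length (filter P? (concatMap (λ a → map (a ∷_) V) (tabulate g))) ≡ ∑[ i < k ] count (λ y → P? (g i ∷ y))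
      blocks {zero}  g = refl
      blocks {suc k} g = begin
        length (filter P? (V₀ ++ W))                   ≡⟨ cong length (filter-++ P? V₀ W) ⟩
        length (filter P? V₀ ++ filter P? W)           ≡⟨ length-++ (filter P? V₀) ⟩
        length (filter P? V₀) + length (filter P? W)   ≡⟨ cong₂ _+_ (length-filter-map P? (g zero ∷_) V) (blocks (g ∘ suc)) ⟩
        count (λ y → P? (g zero ∷ y)) + ∑[ i < k ] count (λ y → P? (g (suc i) ∷ y)) ∎
        where
        open ≡-Reasoning
        V₀ W : List (Vec (Fin N) (suc l))
        V₀ = map (g zero ∷_) V
        W  = concatMap (λ a → map (a ∷_) V) (tabulate (g ∘ suc))

  module _ {N l : ℕ} {P : Pred (Vec (Fin N) (suc l)) 0ℓ} (P? : Decidable P) where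

    count-uniform-head : ∀ c → (∀ a → count (λ y → P? (a ∷ y)) ≡ c) → count P? ≡ N * c
    count-uniform-head c each = trans (count-∷ P?) (trans (sum-cong-≗ each) (sum-const N c))

    count-forced-head : ∀ v → (∀ a y → P (a ∷ y) → a ≡ v) → count P? ≡ count (λ y → P? (v ∷ y))
    count-forced-head v forced = trans (count-∷ P?) (sum-δ +-0-commutativeMonoid _ v none)
      where
      none : ∀ a → a ≢ v → count (λ y → P? (a ∷ y)) ≡ 0
      none a a≢v = count-none (λ y → P? (a ∷ y)) (λ y p → a≢v (forced a y p))

  entrySum : ∀ {N l} → Vec (Fin N) l → ℕ
  entrySum = sumᵛ ∘ mapᵛ toℕ

  SumDivisible : ∀ {n l} → ℕ → Pred (Vec (Fin (suc n)) l) 0ℓ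
  SumDivisible {n} s z = suc n ∣ s + entrySum z

  sumDivisible? : ∀ {n l} s → Decidable (SumDivisible {n} {l} s)
  sumDivisible? {n} s z = suc n ∣? s + entrySum z

  SumDivisible-∷ : ∀ {n l} s a (z : Vec (Fin (suc n)) l) → SumDivisible s (a ∷ z) ⇔ SumDivisible (s + toℕ a) z
  SumDivisible-∷ {n} s a z = mk⇔ (subst (suc n ∣_) (sym (+-assoc s (toℕ a) _))) (subst (suc n ∣_) (+-assoc s (toℕ a) _))

  count-sumDivisible : ∀ {n} t s → count (sumDivisible? {n} {suc t} s) ≡ suc n ^ t
  count-sumDivisible {n} zero s = begin
    count (sumDivisible? {n} {1} s)                ≡⟨ count-forced-head (sumDivisible? s) (negMod s) only-negMod ⟩
    count (λ y → sumDivisible? s (negMod {n} s ∷ y)) ≡⟨ count-[] (λ y → sumDivisible? s (negMod s ∷ y)) s+negMod ⟩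
    1                                              ∎
    where
    only-negMod : ∀ a (y : Vec (Fin (suc n)) 0) → SumDivisible s (a ∷ y) → a ≡ negMod s
    only-negMod a [] d = negMod-unique s a (subst (suc n ∣_) (cong (s +_) (+-identityʳ (toℕ a))) d)
    s+negMod : SumDivisible s (negMod {n} s ∷ [])
    s+negMod = subst (suc n ∣_) (cong (s +_) (sym (+-identityʳ _))) (∣+negMod s)
  count-sumDivisible {n} (suc t) s = count-uniform-head (sumDivisible? s) (suc n ^ t) λ a →
    trans (count-cong (λ y → sumDivisible? s (a ∷ y)) (sumDivisible? (s + toℕ a)) (SumDivisible-∷ s a))
          (count-sumDivisible t (s + toℕ a))

  Prefix : ∀ {A : Set} {l} → ℕ → A → Vec A l → Set
  Prefix q v y = ∀ j → toℕ j < q → lookup y j ≡ v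

  prefix? : ∀ {N l} q (v : Fin N) (y : Vec (Fin N) l) → Dec (Prefix q v y)
  prefix? q v y = all? (λ j → (toℕ j <? q) →-dec (lookup y j ≟ v))

  prefix-∷ : ∀ {A : Set} {l} q (v : A) (y : Vec A l) → Prefix (suc q) v (v ∷ y) ⇔ Prefix q v y
  prefix-∷ q v y = mk⇔ (λ pre j j<q → pre (suc j) (s<s j<q)) (λ { pre zero _ → refl ; pre (suc j) j<q → pre j (s<s⁻¹ j<q) })

  prefixSum? : ∀ {n} q t s (v : Fin (suc n)) → Decidable (λ (y : Vec (Fin (suc n)) (suc (q + t))) → Prefix q v y × SumDivisible s y)
  prefixSum? q t s v y = prefix? q v y ×-dec sumDivisible? s y

  count-prefixSum : ∀ {n} q t s (v : Fin (suc n)) → count (prefixSum? q t s v) ≡ suc n ^ t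
  count-prefixSum {n} zero t s v = begin
    count (prefixSum? 0 t s v)  ≡⟨ count-cong (prefixSum? 0 t s v) (sumDivisible? s) (λ y → mk⇔ proj₂ ((λ _ ()) ,_)) ⟩
    count (sumDivisible? s)     ≡⟨ count-sumDivisible t s ⟩
    suc n ^ t                   ∎
  count-prefixSum {n} (suc q) t s v = begin
    count (prefixSum? (suc q) t s v)                ≡⟨ count-forced-head (prefixSum? (suc q) t s v) v head≡v ⟩
    count (λ y → prefixSum? (suc q) t s v (v ∷ y))  ≡⟨ count-cong _ (prefixSum? q t (s + toℕ v) v) tail⇔ ⟩
    count (prefixSum? q t (s + toℕ v) v)              ≡⟨ count-prefixSum q t (s + toℕ v) v ⟩
    suc n ^ t                                         ∎
    where
    head≡v : ∀ a y → Prefix (suc q) v (a ∷ y) × SumDivisible s (a ∷ y) → a ≡ v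
    head≡v _ _ (pre , _) = pre zero z<s
    tail⇔ : ∀ y → (Prefix (suc q) v (v ∷ y) × SumDivisible s (v ∷ y)) ⇔ (Prefix q v y × SumDivisible (s + toℕ v) y)
    tail⇔ y = prefix-∷ q v y ×-⇔ SumDivisible-∷ s v y

-- The code of the complement of a star

module _ where
  open import Data.Integer using (ℤ; +_; 0ℤ; 1ℤ; _+_; _*_; _-_)
  import Data.Integer.Properties as ℤP
  import Data.Integer.Divisibility.Signed as ℤS
  import Data.Integer as ℤ
  open import Data.Integer.Divisibility using () renaming (_∣_ to _∣ᵤ_)
  open import Data.Nat using (_≤_; _<_; _<ᵇ_; _<?_; s≤s)
  open import Data.Nat.Divisibility using (_∣_)
  open import Data.Nat.Properties using (<ᵇ-reflects-<; <ᵇ⇒<; <⇒<ᵇ; ≤⇒≯; ≮⇒≥; ≤-trans; ≤-reflexive)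
  open import Data.Fin.Properties using (toℕ-fromℕ)
  open import Algebra.Properties.Semiring.Sum ℤP.+-*-semiring using (sum; sum-syntax; sum-cong-≗)
  open import Relation.Nullary.Reflects using (ofʸ; ofⁿ)
  open ≡-Reasoning

  entries : ∀ {N l} → Vec (Fin N) l → Fin l → ℤ
  entries x i = + toℕ (lookup x i)

  sum-entries : ∀ {N l} (x : Vec (Fin N) l) → sum (entries x) ≡ + entrySum x
  sum-entries []      = refl
  sum-entries (a ∷ y) = cong (_+_ (+ toℕ a)) (sum-entries y)

  module _ {m} (G : Graph (suc m)) where

    codeMatrix-laplacian : ∀ i {c} → toℕ c < m → codeMatrix G i c ≡ laplacian G i c
    codeMatrix-laplacian i {c} c<m with toℕ c <ᵇ m | <ᵇ-reflects-< (toℕ c) m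
    ... | true  | _       = refl
    ... | false | ofⁿ c≮m = ⊥-elim (c≮m c<m)

    codeMatrix-ones : ∀ i {c} → m ≤ toℕ c → codeMatrix G i c ≡ 1ℤ
    codeMatrix-ones i {c} m≤c with toℕ c <ᵇ m | <ᵇ-reflects-< (toℕ c) m
    ... | true  | ofʸ c<m = ⊥-elim (≤⇒≯ m≤c c<m)
    ... | false | _       = refl

    codeColumn : Vec (Fin (suc m)) (suc m) → Fin (suc m) → ℤ
    codeColumn x c = sumℤ (λ i → entries x i * codeMatrix G i c)

    codeColumn-laplacian : ∀ x c → toℕ c < m → codeColumn x c ≡ xL G (entries x) c
    codeColumn-laplacian x c c<m = trans (sumℤ≡sum (λ i → entries x i * codeMatrix G i c))
      (sum-cong-≗ (λ i → cong (entries x i *_) (codeMatrix-laplacian i c<m)))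

    codeColumn-ones : ∀ x c → m ≤ toℕ c → codeColumn x c ≡ + entrySum x
    codeColumn-ones x c m≤c = begin
      codeColumn x c                                  ≡⟨ sumℤ≡sum (λ i → entries x i * codeMatrix G i c) ⟩
      ∑[ i < suc m ] (entries x i * codeMatrix G i c) ≡⟨ sum-cong-≗ times-one ⟩
      sum (entries x)                                 ≡⟨ sum-entries x ⟩
      + entrySum x                                    ∎
      where
      times-one : ∀ i → entries x i * codeMatrix G i c ≡ entries x i
      times-one i = trans (cong (entries x i *_) (codeMatrix-ones i m≤c)) (ℤP.*-identityʳ (entries x i))

    CodeConditions : Vec (Fin (suc m)) (suc m) → Set
    CodeConditions x = suc m ∣ entrySum x × (∀ c → toℕ c < m → + suc m ℤS.∣ xL G (entries x) c)

    inCode⇔ : ∀ x → InCode G x ⇔ CodeConditions x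
    inCode⇔ x = mk⇔ to from
      where
      to : InCode G x → CodeConditions x
      to inCode = subst (+ suc m ∣ᵤ_) (codeColumn-ones x (fromℕ m) last) (inCode (fromℕ m))
                , λ c c<m → ℤS.∣ᵤ⇒∣ (subst (+ suc m ∣ᵤ_) (codeColumn-laplacian x c c<m) (inCode c))
        where
        last : m ≤ toℕ (fromℕ m)
        last = ≤-reflexive (sym (toℕ-fromℕ m))
      from : CodeConditions x → InCode G x
      from (m∣∑x , m∣xL) c with toℕ c <? m
      ... | yes c<m = subst (+ suc m ∣ᵤ_) (sym (codeColumn-laplacian x c c<m)) (ℤS.∣⇒∣ᵤ (m∣xL c c<m))
      ... | no  c≮m = subst (+ suc m ∣ᵤ_) (sym (codeColumn-ones x c (≮⇒≥ c≮m))) m∣∑x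

  star : ∀ {m} → ℕ → Graph (suc m)
  star q = record
    { adj    = λ { zero zero → false ; zero (suc j) → toℕ j <ᵇ q ; (suc i) zero → toℕ i <ᵇ q ; (suc i) (suc j) → false }
    ; sym    = λ { zero zero → refl ; zero (suc j) → refl ; (suc i) zero → refl ; (suc i) (suc j) → refl }
    ; irrefl = λ { zero → refl ; (suc i) → refl }
    }

  module _ {m q : ℕ} where

    xL-star-leaf : ∀ (x : Fin (suc m) → ℤ) j → toℕ j < q → xL (star q) x (suc j) ≡ x (suc j) - x zero
    xL-star-leaf x j j<q = xL-pendant (star q) x (suc j) zero (Equivalence.to T-≡ (<⇒<ᵇ j<q)) other
      where
      other : ∀ i → i ≢ zero → adj (star q) i (suc j) ≡ false
      other zero    0≢0 = ⊥-elim (0≢0 refl)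
      other (suc i) _   = refl

    xL-star≡0 : ∀ (x : Fin (suc m) → ℤ) → (∀ j → toℕ j < q → x (suc j) ≡ x zero) → ∀ c → xL (star q) x c ≡ 0ℤ
    xL-star≡0 x leaves c = xL≡0 (star q) x c (constant c)
      where
      constant : ∀ c i → adj (star q) i c ≡ true → x i ≡ x c
      constant (suc j) zero    j<ᵇq = sym (leaves j (<ᵇ⇒< _ _ (Equivalence.from T-≡ j<ᵇq)))
      constant zero    (suc i) i<ᵇq = leaves i (<ᵇ⇒< _ _ (Equivalence.from T-≡ i<ᵇq))

  StarCode : ∀ {m} → ℕ → Pred (Vec (Fin (suc m)) (suc m)) 0ℓ
  StarCode q (x₀ ∷ y) = Prefix q x₀ y × SumDivisible (toℕ x₀) y

  starCode? : ∀ {m} q → Decidable (StarCode {m} q)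
  starCode? q (x₀ ∷ y) = prefix? q x₀ y ×-dec sumDivisible? (toℕ x₀) y

  star-conditions : ∀ {m q} → q < m → ∀ x → CodeConditions (complement (star {m} q)) x ⇔ StarCode q x
  star-conditions {m} {q} q<m (x₀ ∷ y) = mk⇔ to from
    where
    x : Vec (Fin (suc m)) (suc m)
    x = x₀ ∷ y
    ∣∑entries : suc m ∣ entrySum x → + suc m ℤS.∣ sum (entries x)
    ∣∑entries d = ℤS.∣ᵤ⇒∣ (subst (+ suc m ∣ᵤ_) (sym (sum-entries x)) d)
    to : CodeConditions (complement (star q)) x → StarCode q x
    to (m∣∑ , m∣xL) = prefix , m∣∑
      where
      prefix : Prefix q x₀ y
      prefix j j<q = toℕ-injective (small-congruent⇒≡ (toℕ<n xⱼ) (toℕ<n x₀) m∣xⱼ⊖x₀)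
        where
        xⱼ : Fin (suc m)
        xⱼ = lookup y j
        m∣xL-star : + suc m ℤS.∣ xL (star q) (entries x) (suc j)
        m∣xL-star = Equivalence.to (xL-complement-∣ (star q) (entries x) (suc j) (∣∑entries m∣∑))
                                   (m∣xL (suc j) (≤-trans (s≤s j<q) q<m))
        m∣xⱼ⊖x₀ : suc m ∣ ℤ.∣ toℕ xⱼ ℤ.⊖ toℕ x₀ ∣
        m∣xⱼ⊖x₀ = subst (+ suc m ∣ᵤ_) (trans (xL-star-leaf (entries x) j j<q) (ℤP.[+m]-[+n]≡m⊖n (toℕ xⱼ) (toℕ x₀)))
                        (ℤS.∣⇒∣ᵤ m∣xL-star)
    from : StarCode q x → CodeConditions (complement (star q)) x
    from (prefix , m∣∑) = m∣∑ , λ c _ → Equivalence.from (xL-complement-∣ (star q) (entries x) c (∣∑entries m∣∑)) (m∣xL-star c)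
      where
      m∣xL-star : ∀ c → + suc m ℤS.∣ xL (star q) (entries x) c
      m∣xL-star c = subst (+ suc m ℤS.∣_) (sym (xL-star≡0 (entries x) (λ j j<q → cong (+_ ∘ toℕ) (prefix j j<q)) c))
                          (ℤS.divides 0ℤ refl)

  inCode-star : ∀ {m q} → q < m → ∀ x → InCode (complement (star {m} q)) x ⇔ StarCode q x
  inCode-star q<m x = ⇔.trans (inCode⇔ _ x) (star-conditions q<m x)

-- Size, connectivity and rate of the family

module _ where
  open import Data.Nat
    using (_+_; _*_; _∸_; _^_; _/_; _%_; _≤_; _<_; _<ᵇ_; s≤s; s<s; z<s)
  open import Data.Nat.Properties
    using ( module ≤-Reasoning; m≤m+n; m∸n≤m; m∸n+n≡m; <⇒≤; ≤⇒≯; <-≤-trans; n<1+n; m<n⇒m<1+n; <ᵇ-reflects-<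
          ; *-assoc; *-distribˡ-+; *-distribʳ-+; +-mono-≤; +-monoʳ-≤; +-monoˡ-<; +-monoʳ-<
          ; *-monoˡ-≤; *-monoʳ-≤; *-monoˡ-<; *-monoʳ-<; ^-monoʳ-<; ^-distribˡ-+-*; ^-*-assoc )
  open import Data.Nat.DivMod using (m/n*n≤m; m≡m%n+[m/n]*n; m%n<n; /-monoˡ-≤; m*n/n≡m)
  open import Data.Nat.Tactic.RingSolver using (solve-∀)
  open import Data.Fin.Properties using (toℕ-fromℕ)
  open import Relation.Nullary.Reflects using (ofʸ)

  opaque
    unfolding count

    codeSize≡count : ∀ {m} (G : Graph m) → codeSize G ≡ count (InCode? G)
    codeSize≡count G = refl

  codeSize-complement-star : ∀ {m} q t → m ≡ suc (q + t) → codeSize (complement (star {m} q)) ≡ suc m ^ suc t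
  codeSize-complement-star {m} q t refl = begin
    codeSize Ḡ          ≡⟨ codeSize≡count Ḡ ⟩
    count (InCode? Ḡ)   ≡⟨ count-cong (InCode? Ḡ) (starCode? q) (inCode-star (s≤s (m≤m+n q t))) ⟩
    count (starCode? q) ≡⟨ count-uniform-head (starCode? q) (suc m ^ t) (λ a → count-prefixSum q t (toℕ a) a) ⟩
    suc m * suc m ^ t   ∎
    where
    open ≡-Reasoning
    Ḡ : Graph (suc m)
    Ḡ = complement (star q)

  walk-from-hub : ∀ {n} (G : Graph n) u → (∀ i → i ≢ u → adj G i u ≡ true) → ∀ j → Walk G u j
  walk-from-hub G u hub j with j ≟ u
  ... | yes refl = here
  ... | no  j≢u  = step (trans (Graph.sym G u j) (hub j j≢u)) here

  connected-via-hub : ∀ {n} (G : Graph n) u → (∀ i → i ≢ u → adj G i u ≡ true) → Connected G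
  connected-via-hub G u hub i j with i ≟ u
  ... | yes refl = walk-from-hub G u hub j
  ... | no  i≢u  = step (hub i i≢u) (walk-from-hub G u hub j)

  star-last-isolated : ∀ {m q} → q ≤ pred m → ∀ i → adj (star {m} q) i (fromℕ m) ≡ false
  star-last-isolated {zero}  _   zero    = refl
  star-last-isolated {suc p} {q} q≤p zero with toℕ (fromℕ p) <ᵇ q | <ᵇ-reflects-< (toℕ (fromℕ p)) q
  ... | false | _        = refl
  ... | true  | ofʸ p<q  = ⊥-elim (≤⇒≯ q≤p (subst (_< q) (toℕ-fromℕ p) p<q))
  star-last-isolated {suc p} _   (suc i) = refl

  complement-star-connected : ∀ {m} q → q ≤ pred m → Connected (complement (star {m} q))
  complement-star-connected {m} q q≤ = connected-via-hub _ (fromℕ m) λ i i≢last →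
    cong₂ (λ e h → not e ∧ not h) (dec-false (i ≟ fromℕ m) i≢last) (star-last-isolated q≤ i)

  slack-scale : ∀ {u v d k c} → u ≤ v + d → d * k < c → u * k < v * k + c
  slack-scale {u} {v} {d} {k} {c} u≤v+d dk<c = begin-strict
    u * k          ≤⟨ *-monoˡ-≤ k u≤v+d ⟩
    (v + d) * k    ≡⟨ *-distribʳ-+ k v d ⟩
    v * k + d * k  <⟨ +-monoʳ-< (v * k) dk<c ⟩
    v * k + c      ∎
    where open ≤-Reasoning

  RateBounds : (a b n size k : ℕ) → Set
  RateBounds a b n size k = n ^ (n * (a * k)) < size ^ (b * k) * n ^ (n * b) × size ^ (b * k) < n ^ (n * (a * k + b))

  power-bounds : ∀ {n e a b d k} → 1 < n → e * b ≤ n * a + d → n * a ≤ e * b + d → d * k < n * b →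
    RateBounds a b n (n ^ e) k
  power-bounds {n} {e} {a} {b} {d} {k} 1<n eb≤na+d na≤eb+d dk<nb = lower , upper
    where
    open ≤-Reasoning
    lower : n ^ (n * (a * k)) < (n ^ e) ^ (b * k) * n ^ (n * b)
    lower = begin-strict
      n ^ (n * (a * k))                ≡⟨ cong (n ^_) (*-assoc n a k) ⟨
      n ^ (n * a * k)                  <⟨ ^-monoʳ-< n 1<n (slack-scale {v = e * b} {d} na≤eb+d dk<nb) ⟩
      n ^ (e * b * k + n * b)          ≡⟨ ^-distribˡ-+-* n (e * b * k) (n * b) ⟩
      n ^ (e * b * k) * n ^ (n * b)    ≡⟨ cong (λ z → n ^ z * n ^ (n * b)) (*-assoc e b k) ⟩
      n ^ (e * (b * k)) * n ^ (n * b)  ≡⟨ cong (_* n ^ (n * b)) (^-*-assoc n e (b * k)) ⟨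
      (n ^ e) ^ (b * k) * n ^ (n * b)  ∎
    upper : (n ^ e) ^ (b * k) < n ^ (n * (a * k + b))
    upper = begin-strict
      (n ^ e) ^ (b * k)                ≡⟨ ^-*-assoc n e (b * k) ⟩
      n ^ (e * (b * k))                ≡⟨ cong (n ^_) (*-assoc e b k) ⟨
      n ^ (e * b * k)                  <⟨ ^-monoʳ-< n 1<n (slack-scale {v = n * a} {d} eb≤na+d dk<nb) ⟩
      n ^ (n * a * k + n * b)          ≡⟨ cong (λ z → n ^ (z + n * b)) (*-assoc n a k) ⟩
      n ^ (n * (a * k) + n * b)        ≡⟨ cong (n ^_) (*-distribˡ-+ n (a * k) b) ⟨
      n ^ (n * (a * k + b))            ∎

  module _ (a b : ℕ) .{{_ : NonZero b}} where

    leafCount : ℕ → ℕ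
    leafCount m = pred m ∸ pred m * a / b

    family : (n : ℕ) → Odd n → Graph n
    family _ (k , refl) = complement (star (leafCount (2 * k)))

    family-connected : (n : ℕ) (o : Odd n) → Connected (family n o)
    family-connected _ (k , refl) = complement-star-connected _ (m∸n≤m (pred (2 * k)) (pred (2 * k) * a / b))

    module _ (a≤b : a ≤ b) (p : ℕ) where

      quotient≤ : p * a / b ≤ p
      quotient≤ = begin
        p * a / b  ≤⟨ /-monoˡ-≤ b (*-monoʳ-≤ p a≤b) ⟩
        p * b / b  ≡⟨ m*n/n≡m p b ⟩
        p          ∎
        where open ≤-Reasoning

      e*b≤n*a+2b : suc (p * a / b) * b ≤ (2 + p) * a + 2 * b
      e*b≤n*a+2b = begin
        b + p * a / b * b        ≤⟨ +-monoʳ-≤ b (m/n*n≤m (p * a) b) ⟩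
        b + p * a                ≤⟨ m≤m+n (b + p * a) (2 * a + b) ⟩
        b + p * a + (2 * a + b)  ≡⟨ rearrange b p a ⟩
        (2 + p) * a + 2 * b      ∎
        where
        open ≤-Reasoning
        rearrange : ∀ b p a → b + p * a + (2 * a + b) ≡ (2 + p) * a + 2 * b
        rearrange = solve-∀

      n*a≤e*b+2b : (2 + p) * a ≤ suc (p * a / b) * b + 2 * b
      n*a≤e*b+2b = begin
        a + (a + p * a)          ≤⟨ +-mono-≤ a≤b (+-mono-≤ a≤b (<⇒≤ p*a<e*b)) ⟩
        b + (b + e * b)          ≡⟨ rearrange b e ⟩
        e * b + 2 * b            ∎
        where
        open ≤-Reasoning
        e : ℕ
        e = suc (p * a / b)
        p*a<e*b : p * a < e * b
        p*a<e*b = begin-strict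
          p * a                          ≡⟨ m≡m%n+[m/n]*n (p * a) b ⟩
          p * a % b + p * a / b * b      <⟨ +-monoˡ-< (p * a / b * b) (m%n<n (p * a) b) ⟩
          e * b                          ∎
        rearrange : ∀ b e → b + (b + e * b) ≡ e * b + 2 * b
        rearrange = solve-∀

      family-rate-bounds : ∀ k → 2 * k < 2 + p → RateBounds a b (2 + p) (codeSize (complement (star {suc p} (leafCount (suc p))))) k
      family-rate-bounds k 2k<n
        rewrite codeSize-complement-star (p ∸ p * a / b) (p * a / b) (cong suc (sym (m∸n+n≡m quotient≤)))
        = power-bounds {2 + p} {suc (p * a / b)} {a} {b} {2 * b} {k} (s<s z<s) e*b≤n*a+2b n*a≤e*b+2b 2bk<nb
        where
        2bk<nb : 2 * b * k < (2 + p) * b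
        2bk<nb = subst (_< (2 + p) * b) (swap 2 b k) (*-monoˡ-< b 2k<n)
          where
          swap : ∀ x b k → x * k * b ≡ x * b * k
          swap = solve-∀

    family-rate : a ≤ b → RateTendsTo (λ n o → codeSize (family n o)) a b
    family-rate a≤b k _ = suc (2 * suc k) , λ where
      _ (zero  , refl) (s≤s ())
      _ (suc j , refl) N≤n → family-rate-bounds a≤b _ k (<-≤-trans (m<n⇒m<1+n (*-monoʳ-< 2 (n<1+n k))) N≤n)

theorem4p12 : (a b : ℕ) → a ≤ b → 1 ≤ b →
    Σ ((n : ℕ) → Odd n → Graph n) λ G →
      ((n : ℕ) (o : Odd n) → Connected (G n o))
      × RateTendsTo (λ n o → codeSize (G n o)) a b
theorem4p12 a zero      _   ()
theorem4p12 a b@(suc _) a≤b _  = family a b , family-connected a b , family-rate a b a≤b
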